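{- Consider the one-parameter family $E: y^2=x^3-t^2x+t^4$ with parameter $t$. Then for every odd prime $p$ the (unnormalized) first moment of the family at $p$ is $$\sum_{t \bmod p} a_t(p)=-2p.$$
   Context: For an odd prime $p$, $\left(\frac{\cdot}{p}\right)$ denotes the Legendre symbol, with $\left(\frac{u}{p}\right)=0$ if $p\mid u$. For a family $y^2=f_t(x)$ with $f_t(x)$ a cubic polynomial in $x$ with integer coefficients depending polynomially on $t$, one sets $a_t(p):=p-\#\{(x,y)\in(\mathbb{Z}/p\mathbb{Z})^2: y^2\equiv f_t(x) \bmod p\}=-\sum_{x \bmod p}\left(\frac{f_t(x)}{p}\right)$. No condition is imposed on the specialization $t$: all residues $t \bmod p$ are included, also those for which the curve is singular. -}

module Defs where

open import Data.Fin.Base using (Fin; toℕ)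
open import Data.Integer.Base using (ℤ; +_; _+_; _-_; _*_; _^_)
open import Data.Integer.Divisibility.Signed using (_∣_; _∣?_)
open import Data.Integer.Properties using (+-0-commutativeMonoid)
open import Data.List.Base using (List; allFin; cartesianProduct; filter; length)
open import Data.Nat.Base using (ℕ)
open import Data.Product.Base using (_×_; _,_)
open import Relation.Nullary.Decidable.Core using (Dec)

open import Algebra.Properties.CommutativeMonoid.Sum +-0-commutativeMonoid
  using (sum)

infix 4 _≡_[mod_] _≡?_[mod_]

_≡_[mod_] : ℤ → ℤ → ℕ → Set
i ≡ j [mod p ] = + p ∣ i - j

_≡?_[mod_] : (i j : ℤ) (p : ℕ) → Dec (i ≡ j [mod p ])
i ≡? j [mod p ] = + p ∣? i - j

-- Residue classes mod p are represented by Fin p, via 0, …, p - 1.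
residue : ∀ {p} → Fin p → ℤ
residue r = + toℕ r

-- A family y² = f_t(x) is given by f : ℤ → ℤ → ℤ, with the parameter t first.
Family : Set
Family = ℤ → ℤ → ℤ

-- The solutions (x , y) of y² ≡ f_t(x) mod p, each listed exactly once.
solutions : Family → ℤ → (p : ℕ) → List (Fin p × Fin p)
solutions f t p =
  filter (λ (x , y) → residue y ^ 2 ≡? f t (residue x) [mod p ])
         (cartesianProduct (allFin p) (allFin p))

-- Affine points only, and no condition on t: singular fibres are included.
a : Family → ℤ → ℕ → ℤ
a f t p = + p - + length (solutions f t p)

-- The sum is over all t mod p; it does not depend on the chosen
-- representatives when f is given by an integer polynomial in t and x.
firstMoment : Family → ℕ → ℤ
firstMoment f p = sum {p} (λ t → a f (residue t) p)

E : Family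
E t x = x ^ 3 - t ^ 2 * x + t ^ 4

{-# OPTIONS --safe #-}
-- For t ≢ 0 the substitution x = t u, y = t² z turns the fibre into t (z² - 1) ≡ u³ - u,
-- which is linear in t, so its solutions are counted by summing over t first: one t for
-- each (u , z) with z² ≢ 1, and all p or none of the t when z² ≡ 1, according as u³ ≡ u
-- or not.  This gives p² + 4p.  At t ≡ 0 the new equation has 3p solutions, whereas the
-- cuspidal fibre y² ≡ x³ has p.  Hence the family has p² + 2p points.
module Submission where

open import Defs
open import Data.Bool.Base using (if_then_else_; true; false)
open import Data.Fin.Base using (Fin; toℕ; fromℕ<; punchIn; zero; suc)
open import Data.Fin.Properties using (toℕ-fromℕ<; toℕ-injective; toℕ<n; punchInᵢ≢i)
open import Data.Integer.Base
  using (ℤ; +_; -_; _+_; _-_; _*_; _^_; 0ℤ; 1ℤ; -1ℤ; ∣_∣)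
open import Data.Integer.Divisibility.Signed
  using (divides; ∣ᵤ⇒∣; ∣⇒∣ᵤ; ∣m∣n⇒∣m+n; ∣n⇒∣m*n)
  renaming (_∣_ to _∣ℤ_)
open import Data.Integer.DivMod using (_%ℕ_; _/ℕ_; n%ℕd<d; a≡a%ℕn+[a/ℕn]*n)
open import Data.Integer.Properties
  using (abs-*; pos-*; *-identityˡ; *-identityʳ; *-zeroˡ; *-zeroʳ; +-identityˡ; +-identityʳ;
         *-comm; i≡j⇒i-j≡0; [+m]-[+n]≡m⊖n; ⊖-≥; +-*-semiring)
open import Data.Integer.Solver using (module +-*-Solver)
open import Data.List.Base
  using ([]; _∷_; _++_; map; filter; length; tabulate; cartesianProduct)
open import Data.List.Properties using (filter-++; length-++)
open import Data.Nat.Base as ℕ using (ℕ; NonZero)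
import Data.Nat.Properties as ℕ
open import Data.Nat.Coprimality using (coprime-Bézout; prime⇒coprime)
open import Data.Nat.Divisibility using (_∣_; ∣-refl; >⇒∤)
open import Data.Nat.GCD using (module Bézout)
open import Data.Nat.Primality
  using (Prime; euclidsLemma; prime⇒nonZero; ¬prime[1]; prime[2]; prime⇒irreducible)
open import Data.Product.Base using (Σ; _×_; _,_; ∃-syntax)
open import Data.Sum.Base as Sum using (_⊎_; inj₁; inj₂; [_,_]′)
open import Function.Base using (_∘_; id; const)
open import Function.Bundles using (mk⇔)
open import Relation.Binary.PropositionalEquality
  using (_≡_; _≢_; refl; sym; trans; cong; cong₂; subst; module ≡-Reasoning)
open import Relation.Nullary.Decidable
  using (Dec; yes; no; does; does-⇔; map′; dec-true; dec-false)
open import Relation.Nullary.Negation using (¬_; contradiction)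
open import Relation.Unary using (Decidable)

open import Algebra.Properties.Semiring.Sum +-*-semiring
  using (sum; sum-cong-≗; sum-remove; sum-replicate-zero; ∑-distrib-+; ∑-comm; *-distribˡ-sum)
open +-*-Solver using (solve; _:+_; _:*_; _:-_; _:^_; :-_; _:=_; con)
open ≡-Reasoning

-- Indicators, and point counts as sums.

𝟙 : {P : Set} → Dec P → ℤ
𝟙 P? = if does P? then 1ℤ else 0ℤ

𝟙-true : {P : Set} (P? : Dec P) → P → 𝟙 P? ≡ 1ℤ
𝟙-true P? x = cong (if_then 1ℤ else 0ℤ) (dec-true P? x)

𝟙-false : {P : Set} (P? : Dec P) → ¬ P → 𝟙 P? ≡ 0ℤ
𝟙-false P? ¬x = cong (if_then 1ℤ else 0ℤ) (dec-false P? ¬x)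

𝟙-⇔ : {P Q : Set} (P? : Dec P) (Q? : Dec Q) → (P → Q) → (Q → P) → 𝟙 P? ≡ 𝟙 Q?
𝟙-⇔ P? Q? f g = cong (if_then 1ℤ else 0ℤ) (does-⇔ (mk⇔ f g) P? Q?)

-- Disjointness keeps a common case from being counted twice. This makes the root count of a
-- factored polynomial additive.
𝟙-⊎ : {P Q R : Set} (P? : Dec P) (Q? : Dec Q) (R? : Dec R) →
      (P → Q ⊎ R) → (Q → P) → (R → P) → (Q → ¬ R) → 𝟙 P? ≡ 𝟙 Q? + 𝟙 R?
𝟙-⊎ P? (yes q) R? _ g _ k = trans (𝟙-true P? (g q)) (cong (_+_ 1ℤ) (sym (𝟙-false R? (k q))))
𝟙-⊎ P? (no ¬q) R? f _ h _ =
  trans (𝟙-⇔ P? R? ([ (λ q → contradiction q ¬q) , id ]′ ∘ f) h) (sym (+-identityˡ _))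

sum-const : ∀ n c → sum {n} (const c) ≡ + n * c
sum-const ℕ.zero    c = sym (*-zeroˡ c)
sum-const (ℕ.suc n) c = trans (cong (_+_ c) (sum-const n c))
  (solve 2 (λ c n → c :+ n :* c := (con 1ℤ :+ n) :* c) refl c (+ n))

length-filter-tabulate : ∀ {A : Set} {P : A → Set} (P? : Decidable P) {n} (f : Fin n → A) →
  + length (filter P? (tabulate f)) ≡ sum (λ i → 𝟙 (P? (f i)))
length-filter-tabulate P? {ℕ.zero}  f = refl
length-filter-tabulate P? {ℕ.suc n} f with does (P? (f zero))
... | true  = cong (_+_ 1ℤ) (length-filter-tabulate P? (f ∘ suc))
... | false = trans (length-filter-tabulate P? (f ∘ suc)) (sym (+-identityˡ _))

length-filter-map : ∀ {A B : Set} {P : B → Set} (P? : Decidable P) (f : A → B) xs →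
  length (filter P? (map f xs)) ≡ length (filter (P? ∘ f) xs)
length-filter-map P? f []       = refl
length-filter-map P? f (x ∷ xs) with does (P? (f x))
... | true  = cong ℕ.suc (length-filter-map P? f xs)
... | false = length-filter-map P? f xs

-- By induction on the rows. It turns a list of points into a double sum, which can then be
-- reordered and substituted into.
length-filter-cartesianProduct :
  ∀ {A B : Set} {P : A × B → Set} (P? : Decidable P) {m n} (f : Fin m → A) (g : Fin n → B) →
  + length (filter P? (cartesianProduct (tabulate f) (tabulate g))) ≡
  sum (λ i → sum (λ j → 𝟙 (P? (f i , g j))))
length-filter-cartesianProduct P? {ℕ.zero}  f g = refl
length-filter-cartesianProduct P? {ℕ.suc m} f g = begin
  + length (filter P? (row ++ rest))
    ≡⟨ cong (λ l → + length l) (filter-++ P? row rest) ⟩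
  + length (filter P? row ++ filter P? rest)
    ≡⟨ cong +_ (length-++ (filter P? row)) ⟩
  + length (filter P? row) + + length (filter P? rest)
    ≡⟨ cong₂ _+_
         (trans (cong +_ (length-filter-map P? (f zero ,_) (tabulate g)))
                (length-filter-tabulate (λ b → P? (f zero , b)) g))
         (length-filter-cartesianProduct P? (f ∘ suc) g) ⟩
  _ ∎
  where
  row  = map (f zero ,_) (tabulate g)
  rest = cartesianProduct (tabulate (f ∘ suc)) (tabulate g)

sum-single : ∀ {n} (f : Fin n → ℤ) i → (∀ j → j ≢ i → f j ≡ 0ℤ) → sum f ≡ f i
sum-single {ℕ.suc n} f i f≡0 = begin
  sum f                              ≡⟨ sum-remove {i = i} f ⟩
  f i + sum (λ j → f (punchIn i j))
    ≡⟨ cong (_+_ (f i)) (sum-cong-≗ (λ j → f≡0 (punchIn i j) (punchInᵢ≢i i j))) ⟩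
  f i + sum {n} (const 0ℤ)           ≡⟨ cong (_+_ (f i)) (sum-replicate-zero n) ⟩
  f i + 0ℤ                           ≡⟨ +-identityʳ (f i) ⟩
  f i                                ∎

-- Congruences and sums over residues.

module Congruence (p : ℕ) where

  -- A record, because i and j cannot be inferred from + p ∣ i - j.
  infix 4 _≋_ _≋?_
  record _≋_ (i j : ℤ) : Set where
    constructor mod
    field unmod : i ≡ j [mod p ]
  open _≋_ public

  _≋?_ : ∀ i j → Dec (i ≋ j)
  i ≋? j = map′ mod unmod (i ≡? j [mod p ])

  -- The premise is an integer identity between differences, so deducing one congruence from another
  -- is left to the ring solver.
  mod-scale : ∀ {i j k l} m → k - l ≡ m * (i - j) → i ≋ j → k ≋ l
  mod-scale m eq (mod i≡j) = mod (subst (+ p ∣ℤ_) (sym eq) (∣n⇒∣m*n m i≡j))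

  mod-sym : ∀ {i j} → i ≋ j → j ≋ i
  mod-sym {i} {j} = mod-scale -1ℤ (solve 2 (λ i j → j :- i := con -1ℤ :* (i :- j)) refl i j)

  mod-trans : ∀ {i j k} → i ≋ j → j ≋ k → i ≋ k
  mod-trans {i} {j} {k} (mod i≡j) (mod j≡k) = mod (subst (+ p ∣ℤ_)
    (solve 3 (λ i j k → (i :- j) :+ (j :- k) := i :- k) refl i j k) (∣m∣n⇒∣m+n i≡j j≡k))

  mod-refl : ∀ {i} → i ≋ i
  mod-refl {i} = mod (divides 0ℤ (i≡j⇒i-j≡0 {i} refl))

  mod-+ : ∀ {i i′ j j′} → i ≋ i′ → j ≋ j′ → i + j ≋ i′ + j′
  mod-+ {i} {i′} {j} {j′} (mod h) (mod k) = mod (subst (+ p ∣ℤ_)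
    (solve 4 (λ i i′ j j′ → (i :- i′) :+ (j :- j′) := (i :+ j) :- (i′ :+ j′)) refl i i′ j j′)
    (∣m∣n⇒∣m+n h k))

  mod-* : ∀ {i i′ j j′} → i ≋ i′ → j ≋ j′ → i * j ≋ i′ * j′
  mod-* {i} {i′} {j} {j′} h k = mod-trans
    (mod-scale j (solve 3 (λ i i′ j → i :* j :- i′ :* j := j :* (i :- i′)) refl i i′ j) h)
    (mod-scale i′ (solve 3 (λ i′ j j′ → i′ :* j :- i′ :* j′ := i′ :* (j :- j′)) refl i′ j j′) k)

  mod-neg : ∀ {i j} → i ≋ j → - i ≋ - j
  mod-neg {i} {j} = mod-scale -1ℤ (solve 2 (λ i j → :- i :- :- j := con -1ℤ :* (i :- j)) refl i j)

  mod-^ : ∀ {i j} n → i ≋ j → i ^ n ≋ j ^ n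
  mod-^ ℕ.zero    _   = mod-refl
  mod-^ (ℕ.suc n) i≡j = mod-* i≡j (mod-^ n i≡j)

  mod-E : ∀ {t t′ x x′} → t ≋ t′ → x ≋ x′ → E t x ≋ E t′ x′
  mod-E h k =
    mod-+ (mod-+ (mod-^ 3 k) (mod-neg (mod-* (mod-^ 2 h) k))) (mod-^ 4 h)

  infix 8 [_≋_]
  [_≋_] : ℤ → ℤ → ℤ
  [ i ≋ j ] = 𝟙 (i ≋? j)

  ≋-⇔ : ∀ {i j k l} → (i ≋ j → k ≋ l) → (k ≋ l → i ≋ j) →
        [ i ≋ j ] ≡ [ k ≋ l ]
  ≋-⇔ = 𝟙-⇔ (_ ≋? _) (_ ≋? _)

  ≋-cong : ∀ {i i′ j j′} → i ≋ i′ → j ≋ j′ → [ i ≋ j ] ≡ [ i′ ≋ j′ ]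
  ≋-cong h k = ≋-⇔ (λ e → mod-trans (mod-sym h) (mod-trans e k))
                   (λ e → mod-trans h (mod-trans e (mod-sym k)))

  -- Summands live on all of `ℤ`, so that arguments such as `c * i` need no reduction modulo `p`.
  ∑ : (ℤ → ℤ) → ℤ
  ∑ f = sum {p} (f ∘ residue)

  ∑-cong : ∀ {f g} → (∀ i → f i ≡ g i) → ∑ f ≡ ∑ g
  ∑-cong f≗g = sum-cong-≗ {p} (f≗g ∘ residue)

  ∑-const : ∀ c → ∑ (const c) ≡ + p * c
  ∑-const = sum-const p

  ∑-+ : ∀ f g → ∑ (λ i → f i + g i) ≡ ∑ f + ∑ g
  ∑-+ f g = ∑-distrib-+ {p} (f ∘ residue) (g ∘ residue)

  ∑-*ˡ : ∀ c f → ∑ (λ i → c * f i) ≡ c * ∑ f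
  ∑-*ˡ c f = sym (*-distribˡ-sum {p} c (f ∘ residue))

  ∑-swap : ∀ (f : ℤ → ℤ → ℤ) → ∑ (λ i → ∑ (f i)) ≡ ∑ (λ j → ∑ (λ i → f i j))
  ∑-swap f = ∑-comm {p} {p} (λ i j → f (residue i) (residue j))

  ∑-affine : ∀ b c f → ∑ (λ i → b + c * f i) ≡ + p * b + c * ∑ f
  ∑-affine b c f = trans (∑-+ (const b) (λ i → c * f i)) (cong₂ _+_ (∑-const b) (∑-*ˡ c f))

  -- These are the functions that descend to residue classes, hence those in which a change of
  -- variable is legitimate.
  Periodic : (ℤ → ℤ) → Set
  Periodic f = ∀ {i j} → i ≋ j → f i ≡ f j

  a-E : ∀ t → a E t p ≡ + p - ∑ (λ x → ∑ (λ y → [ y ^ 2 ≋ E t x ]))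
  -- `_≋?_` is a `map′` of `_≡?_[mod_]` and so has the same `does`; the two indicators agree by
  -- computation.
  a-E t = cong (λ n → + p - n) (length-filter-cartesianProduct
    (λ (x , y) → residue y ^ 2 ≡? E t (residue x) [mod p ]) {p} {p} id id)

  -- A natural number below `p` that `p` divides is zero. Ordering the two residues first makes
  -- truncated subtraction the true difference.
  residue-injective : ∀ (r s : Fin p) → residue r ≋ residue s → r ≡ s
  residue-injective r s r≡s = toℕ-injective (wlog r s r≡s)
    where
    ≤-case : ∀ (r s : Fin p) → toℕ s ℕ.≤ toℕ r → residue r ≋ residue s → toℕ r ≡ toℕ s
    ≤-case r s s≤r (mod r≡s)
      with toℕ r ℕ.∸ toℕ s in eq
         | ∣⇒∣ᵤ (subst (+ p ∣ℤ_) (trans ([+m]-[+n]≡m⊖n (toℕ r) (toℕ s)) (⊖-≥ s≤r)) r≡s)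
    ... | ℕ.zero  | _   = ℕ.≤-antisym (ℕ.m∸n≡0⇒m≤n eq) s≤r
    ... | ℕ.suc d | p∣d = contradiction p∣d
      (>⇒∤ (subst (ℕ._< p) eq (ℕ.≤-<-trans (ℕ.m∸n≤m (toℕ r) (toℕ s)) (toℕ<n r))))

    wlog : ∀ (r s : Fin p) → residue r ≋ residue s → toℕ r ≡ toℕ s
    wlog r s r≡s with ℕ.≤-total (toℕ s) (toℕ r)
    ... | inj₁ s≤r = ≤-case r s s≤r r≡s
    ... | inj₂ r≤s = sym (≤-case s r r≤s (mod-sym r≡s))

-- Unique representatives modulo `p`.

module NonZeroModulus (p : ℕ) .{{_ : NonZero p}} where

  open Congruence p public

  mod-% : ∀ i → i ≋ + (i %ℕ p)
  mod-% i = mod (divides (i /ℕ p) (trans (cong (_- + (i %ℕ p)) (a≡a%ℕn+[a/ℕn]*n i p))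
    (solve 2 (λ r q → (r :+ q) :- r := q) refl (+ (i %ℕ p)) ((i /ℕ p) * + p))))

  -- The indicator acts as a Kronecker delta: among the representatives only the remainder of `i` is
  -- congruent to `i`.
  sift : ∀ {f} → Periodic f → ∀ i → ∑ (λ j → f j * [ j ≋ i ]) ≡ f i
  sift {f} f-periodic i = begin
    ∑ (λ j → f j * [ j ≋ i ])          ≡⟨ sum-single _ r other-zero ⟩
    f (residue r) * [ residue r ≋ i ]  ≡⟨ cong (f (residue r) *_) (𝟙-true (_ ≋? _) r≡i) ⟩
    f (residue r) * 1ℤ                 ≡⟨ *-identityʳ _ ⟩
    f (residue r)                      ≡⟨ f-periodic r≡i ⟩
    f i                                ∎
    where
    r : Fin p
    r = fromℕ< (n%ℕd<d i p)
    r≡i : residue r ≋ i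
    r≡i = mod-sym (subst (λ n → i ≋ + n) (sym (toℕ-fromℕ< (n%ℕd<d i p))) (mod-% i))
    other-zero : ∀ s → s ≢ r → f (residue s) * [ residue s ≋ i ] ≡ 0ℤ
    other-zero s s≢r = trans
      (cong (f (residue s) *_) (𝟙-false (_ ≋? _) (λ s≡i →
        s≢r (residue-injective s r (mod-trans s≡i (mod-sym r≡i))))))
      (*-zeroʳ (f (residue s)))

  ∑-≋ : ∀ i → ∑ (λ j → [ j ≋ i ]) ≡ 1ℤ
  ∑-≋ i = trans (∑-cong (λ j → sym (*-identityˡ [ j ≋ i ]))) (sift {f = const 1ℤ} (λ _ → refl) i)

-- Linear congruences and substitutions modulo a prime.

module PrimeModulus (p : ℕ) (p-prime : Prime p) where

  private instance
    p≢0 : NonZero p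
    p≢0 = prime⇒nonZero p-prime

  open NonZeroModulus p {{p≢0}} public

  -- Euclid's lemma on absolute values, phrased with differences so that any factorization of
  -- `m - n` can be supplied as an identity.
  mod-euclid : ∀ {i j k l m n} → m - n ≡ (i - j) * (k - l) → m ≋ n → i ≋ j ⊎ k ≋ l
  mod-euclid {i} {j} {k} {l} eq (mod m≡n) =
    Sum.map (λ h → mod (∣ᵤ⇒∣ h)) (λ h → mod (∣ᵤ⇒∣ h))
      (euclidsLemma ∣ i - j ∣ ∣ k - l ∣ p-prime
        (subst (p ∣_) (trans (cong ∣_∣ eq) (abs-* (i - j) (k - l))) (∣⇒∣ᵤ m≡n)))

  ≢0-* : ∀ {i j} → ¬ i ≋ 0ℤ → ¬ j ≋ 0ℤ → ¬ i * j ≋ 0ℤ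
  ≢0-* {i} {j} i≢0 j≢0 = [ i≢0 , j≢0 ]′ ∘ mod-euclid
    (solve 2 (λ i j → i :* j :- con 0ℤ := (i :- con 0ℤ) :* (j :- con 0ℤ)) refl i j)

  -- Bézout's identity for `p` and the remainder `r` of `c`. Over the naturals it has two forms:
  -- `1 + y * r = x * p` gives the inverse `- y`, and `1 + x * p = y * r` gives `y`.
  mod-inverse : ∀ c → ¬ c ≋ 0ℤ → ∃[ d ] d * c ≋ 1ℤ
  mod-inverse c c≢0 with c %ℕ p | n%ℕd<d c p | mod-% c
  ... | ℕ.zero      | _   | c≡0 = contradiction c≡0 c≢0
  ... | r@(ℕ.suc _) | r<p | c≡r with coprime-Bézout (prime⇒coprime p-prime r<p)
  ...   | Bézout.+- x y eq =
    - + y , mod-trans (mod-* {i = - + y} mod-refl c≡r) (mod (divides (- + x) (begin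
    - + y * + r - 1ℤ
      ≡⟨ solve 2 (λ y r → :- y :* r :- con 1ℤ := :- (con 1ℤ :+ y :* r)) refl (+ y) (+ r) ⟩
    - (1ℤ + + y * + r)    ≡⟨ cong (λ n → - (1ℤ + n)) (sym (pos-* y r)) ⟩
    - + (1 ℕ.+ y ℕ.* r)   ≡⟨ cong (λ n → - + n) eq ⟩
    - + (x ℕ.* p)         ≡⟨ cong -_ (pos-* x p) ⟩
    - (+ x * + p)         ≡⟨ solve 2 (λ x p → :- (x :* p) := :- x :* p) refl (+ x) (+ p) ⟩
    - + x * + p           ∎)))
  ...   | Bézout.-+ x y eq =
    + y , mod-trans (mod-* {i = + y} mod-refl c≡r) (mod (divides (+ x) (begin
    + y * + r - 1ℤ        ≡⟨ cong (_- 1ℤ) (sym (pos-* y r)) ⟩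
    + (y ℕ.* r) - 1ℤ      ≡⟨ cong (λ n → + n - 1ℤ) (sym eq) ⟩
    1ℤ + + (x ℕ.* p) - 1ℤ ≡⟨ cong (λ n → 1ℤ + n - 1ℤ) (pos-* x p) ⟩
    1ℤ + + x * + p - 1ℤ   ≡⟨ solve 1 (λ n → con 1ℤ :+ n :- con 1ℤ := n) refl (+ x * + p) ⟩
    + x * + p             ∎)))

  -- The one solution is `d * j`, with `d` the inverse of `c`.
  ∑-linear : ∀ {c} → ¬ c ≋ 0ℤ → ∀ j → ∑ (λ i → [ c * i ≋ j ]) ≡ 1ℤ
  ∑-linear {c} c≢0 j = trans (∑-cong (λ i → ≋-⇔ (to i) (from i))) (∑-≋ (d * j))
    where
    open Σ (mod-inverse c c≢0) renaming (proj₁ to d; proj₂ to dc≡1)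
    to : ∀ i → c * i ≋ j → i ≋ d * j
    to i ci≡j = mod-trans
      (mod-scale (- i)
        (solve 3 (λ c d i → i :- d :* (c :* i) := :- i :* (d :* c :- con 1ℤ)) refl c d i) dc≡1)
      (mod-* {i = d} mod-refl ci≡j)
    from : ∀ i → i ≋ d * j → c * i ≋ j
    from i i≡dj = mod-trans
      (mod-* {i = c} mod-refl i≡dj)
      (mod-scale j
        (solve 3 (λ c d j → c :* (d :* j) :- j := j :* (d :* c :- con 1ℤ)) refl c d j) dc≡1)

  -- Multiplication by a unit permutes the residues. No permutation is built: each `f i` is weighted
  -- by the number of `j` with `c * j ≋ i`, which is one, and after the swap `sift` evaluates the
  -- sum over `i`.
  ∑-scale : ∀ {c} → ¬ c ≋ 0ℤ → ∀ {f} → Periodic f → ∑ f ≡ ∑ (λ i → f (c * i))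
  ∑-scale {c} c≢0 {f} f-periodic = begin
    ∑ f
      ≡⟨ ∑-cong (λ i → trans (sym (*-identityʳ (f i))) (cong (f i *_) (sym (∑-linear c≢0 i)))) ⟩
    ∑ (λ i → f i * ∑ (λ j → [ c * j ≋ i ]))
      ≡⟨ ∑-cong (λ i → sym (∑-*ˡ (f i) (λ j → [ c * j ≋ i ]))) ⟩
    ∑ (λ i → ∑ (λ j → f i * [ c * j ≋ i ]))
      ≡⟨ ∑-swap (λ i j → f i * [ c * j ≋ i ]) ⟩
    ∑ (λ j → ∑ (λ i → f i * [ c * j ≋ i ]))
      ≡⟨ ∑-cong (λ j → ∑-cong (λ i → cong (f i *_)
           (≋-⇔ (mod-sym {c * j} {i}) (mod-sym {i} {c * j})))) ⟩
    ∑ (λ j → ∑ (λ i → f i * [ i ≋ c * j ]))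
      ≡⟨ ∑-cong (λ j → sift f-periodic (c * j)) ⟩
    ∑ (λ j → f (c * j)) ∎

  ≋-scale : ∀ {m i j k l} → ¬ m ≋ 0ℤ → k - l ≡ m * (i - j) → [ k ≋ l ] ≡ [ i ≋ j ]
  ≋-scale {m} {i} {j} {k} {l} m≢0 eq = ≋-⇔ to (mod-scale m eq)
    where
    to : k ≋ l → i ≋ j
    to k≡l with mod-euclid (trans eq (cong (_* (i - j)) (sym (+-identityʳ m)))) k≡l
    ... | inj₁ m≡0 = contradiction m≡0 m≢0
    ... | inj₂ i≡j = i≡j

  ≋-product : ∀ {i j k l m n} → m - n ≡ (i - j) * (k - l) → (i ≋ j → ¬ k ≋ l) →
              [ m ≋ n ] ≡ [ i ≋ j ] + [ k ≋ l ]
  ≋-product {i} {j} {k} {l} {m} {n} eq disjoint =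
    𝟙-⊎ (m ≋? n) (i ≋? j) (k ≋? l) (mod-euclid eq)
      (mod-scale (k - l) (trans eq (*-comm (i - j) (k - l)))) (mod-scale (i - j) eq) disjoint

  -- One solution for a unit `c`; otherwise `p` or none, as `j` vanishes or not. Written as a
  -- polynomial in two indicators, the case distinction can itself be summed over `c` and `j`.
  ∑-linear-any : ∀ c j → ∑ (λ i → [ c * i ≋ j ]) ≡ 1ℤ + (+ p * [ j ≋ 0ℤ ] - 1ℤ) * [ c ≋ 0ℤ ]
  ∑-linear-any c j with c ≋? 0ℤ
  ... | no c≢0 = begin
    ∑ (λ i → [ c * i ≋ j ])               ≡⟨ ∑-linear c≢0 j ⟩
    1ℤ
      ≡⟨ solve 1 (λ m → con 1ℤ := con 1ℤ :+ m :* con 0ℤ) refl (+ p * [ j ≋ 0ℤ ] - 1ℤ) ⟩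
    1ℤ + (+ p * [ j ≋ 0ℤ ] - 1ℤ) * 0ℤ
      ≡⟨ cong (λ k → 1ℤ + (+ p * [ j ≋ 0ℤ ] - 1ℤ) * k) (sym (𝟙-false (c ≋? 0ℤ) c≢0)) ⟩
    1ℤ + (+ p * [ j ≋ 0ℤ ] - 1ℤ) * [ c ≋ 0ℤ ] ∎
  ... | yes c≡0 = begin
    ∑ (λ i → [ c * i ≋ j ])               ≡⟨ ∑-cong (λ i → ≋-⇔ (to i) (from i)) ⟩
    ∑ (const [ j ≋ 0ℤ ])                  ≡⟨ ∑-const [ j ≋ 0ℤ ] ⟩
    + p * [ j ≋ 0ℤ ]
      ≡⟨ solve 1 (λ m → m := con 1ℤ :+ (m :- con 1ℤ) :* con 1ℤ) refl (+ p * [ j ≋ 0ℤ ]) ⟩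
    1ℤ + (+ p * [ j ≋ 0ℤ ] - 1ℤ) * 1ℤ
      ≡⟨ cong (λ k → 1ℤ + (+ p * [ j ≋ 0ℤ ] - 1ℤ) * k) (sym (𝟙-true (c ≋? 0ℤ) c≡0)) ⟩
    1ℤ + (+ p * [ j ≋ 0ℤ ] - 1ℤ) * [ c ≋ 0ℤ ] ∎
    where
    ci≡0 : ∀ i → c * i ≋ 0ℤ
    ci≡0 i = mod-scale i (solve 2 (λ c i → c :* i :- con 0ℤ := i :* (c :- con 0ℤ)) refl c i) c≡0
    to : ∀ i → c * i ≋ j → j ≋ 0ℤ
    to i ci≡j = mod-trans (mod-sym ci≡j) (ci≡0 i)
    from : ∀ i → j ≋ 0ℤ → c * i ≋ j
    from i j≡0 = mod-trans (ci≡0 i) (mod-sym j≡0)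

-- Root counts modulo an odd prime.

module OddPrimeModulus (p : ℕ) (p-prime : Prime p) (p-odd : ¬ 2 ∣ p) where

  open PrimeModulus p p-prime public

  -- Oddness enters here: the difference is 2, whose only divisors are 1 and 2.
  1≢-1 : ¬ 1ℤ ≋ -1ℤ
  1≢-1 (mod p∣2) with prime⇒irreducible prime[2] (∣⇒∣ᵤ p∣2)
  ... | inj₁ refl = ¬prime[1] p-prime
  ... | inj₂ refl = p-odd ∣-refl

  1≢0 : ¬ 1ℤ ≋ 0ℤ
  1≢0 = 1≢-1 ∘ mod-scale (+ 2) refl

  ∑-square : ∑ (λ z → [ z ^ 2 ≋ 1ℤ ]) ≡ + 2
  ∑-square = begin
    ∑ (λ z → [ z ^ 2 ≋ 1ℤ ])
      ≡⟨ ∑-cong (λ z → ≋-product {z} {1ℤ} {z} { -1ℤ} {z ^ 2} {1ℤ} (factor z)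
           (λ z≡1 z≡-1 → 1≢-1 (mod-trans (mod-sym z≡1) z≡-1))) ⟩
    ∑ (λ z → [ z ≋ 1ℤ ] + [ z ≋ -1ℤ ])    ≡⟨ ∑-+ (λ z → [ z ≋ 1ℤ ]) (λ z → [ z ≋ -1ℤ ]) ⟩
    ∑ (λ z → [ z ≋ 1ℤ ]) + ∑ (λ z → [ z ≋ -1ℤ ]) ≡⟨ cong₂ _+_ (∑-≋ 1ℤ) (∑-≋ -1ℤ) ⟩
    + 2                                   ∎
    where
    factor : ∀ z → z ^ 2 - 1ℤ ≡ (z - 1ℤ) * (z - -1ℤ)
    factor = solve 1 (λ z → z :^ 2 :- con 1ℤ := (z :- con 1ℤ) :* (z :- con -1ℤ)) refl

  -- The roots are 0 and the two square roots of 1; a common root of both factors would give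
  -- `1ℤ ≋ 0ℤ`.
  ∑-cube : ∑ (λ u → [ u ^ 3 ≋ u ]) ≡ + 3
  ∑-cube = begin
    ∑ (λ u → [ u ^ 3 ≋ u ])
      ≡⟨ ∑-cong (λ u → ≋-product {u} {0ℤ} {u ^ 2} {1ℤ} {u ^ 3} {u} (factor u)
           (λ u≡0 u²≡1 → 1≢0 (mod-trans (mod-sym u²≡1) (mod-^ 2 u≡0)))) ⟩
    ∑ (λ u → [ u ≋ 0ℤ ] + [ u ^ 2 ≋ 1ℤ ]) ≡⟨ ∑-+ (λ u → [ u ≋ 0ℤ ]) (λ u → [ u ^ 2 ≋ 1ℤ ]) ⟩
    ∑ (λ u → [ u ≋ 0ℤ ]) + ∑ (λ u → [ u ^ 2 ≋ 1ℤ ]) ≡⟨ cong₂ _+_ (∑-≋ 0ℤ) ∑-square ⟩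
    + 3                                   ∎
    where
    factor : ∀ u → u ^ 3 - u ≡ (u - 0ℤ) * (u ^ 2 - 1ℤ)
    factor = solve 1 (λ u → u :^ 3 :- u := (u :- con 0ℤ) :* (u :^ 2 :- con 1ℤ)) refl

  -- Point counts of the fibres.

  fibre : ℤ → ℤ
  fibre t = ∑ (λ x → ∑ (λ y → [ y ^ 2 ≋ E t x ]))

  linearFibre : ℤ → ℤ
  linearFibre t = ∑ (λ u → ∑ (λ z → [ (z ^ 2 - 1ℤ) * t ≋ u ^ 3 - u ]))

  fibre-≢0 : ∀ {t} → ¬ t ≋ 0ℤ → fibre t ≡ linearFibre t
  fibre-≢0 {t} t≢0 = begin
    ∑ (λ x → ∑ (λ y → [ y ^ 2 ≋ E t x ]))
      ≡⟨ ∑-scale t≢0 (λ x≡x′ → ∑-cong (λ y → ≋-cong (mod-refl {y ^ 2}) (mod-E (mod-refl {t}) x≡x′))) ⟩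
    ∑ (λ u → ∑ (λ y → [ y ^ 2 ≋ E t (t * u) ]))
      ≡⟨ ∑-cong (λ u → ∑-scale t²≢0 (λ y≡y′ → ≋-cong (mod-^ 2 y≡y′) (mod-refl {E t (t * u)}))) ⟩
    ∑ (λ u → ∑ (λ z → [ (t * t * z) ^ 2 ≋ E t (t * u) ]))
      -- After the substitution every term carries the unit `t ^ 3`. Cancelling it leaves `t` to the
      -- first power only.
      ≡⟨ ∑-cong (λ u → ∑-cong (λ z → ≋-scale {i = (z ^ 2 - 1ℤ) * t} {u ^ 3 - u} {(t * t * z) ^ 2} {E t (t * u)}
           (≢0-* t²≢0 t≢0) (factor t u z))) ⟩
    ∑ (λ u → ∑ (λ z → [ (z ^ 2 - 1ℤ) * t ≋ u ^ 3 - u ])) ∎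
    where
    t²≢0 : ¬ t * t ≋ 0ℤ
    t²≢0 = ≢0-* t≢0 t≢0
    factor : ∀ t u z →
      (t * t * z) ^ 2 - E t (t * u) ≡ (t * t * t) * ((z ^ 2 - 1ℤ) * t - (u ^ 3 - u))
    factor = solve 3 (λ t u z →
      (t :* t :* z) :^ 2 :- ((t :* u) :^ 3 :- t :^ 2 :* (t :* u) :+ t :^ 4) :=
      (t :* t :* t) :* ((z :^ 2 :- con 1ℤ) :* t :- (u :^ 3 :- u))) refl

  -- The cuspidal cubic is parametrized by x = w², y = w x.
  cusp : ∀ x → ∑ (λ y → [ y ^ 2 ≋ x ^ 3 ]) ≡ ∑ (λ w → [ w ^ 2 ≋ x ])
  cusp x with x ≋? 0ℤ
  -- At the cusp `y = w x` is no bijection, but both right-hand sides vanish and the equations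
  -- coincide.
  ... | yes x≡0 = ∑-cong (λ y → ≋-cong (mod-refl {y ^ 2}) (mod-trans (mod-^ 3 x≡0) (mod-sym x≡0)))
  ... | no x≢0  = begin
    ∑ (λ y → [ y ^ 2 ≋ x ^ 3 ])
      ≡⟨ ∑-scale x≢0 (λ y≡y′ → ≋-cong (mod-^ 2 y≡y′) (mod-refl {x ^ 3})) ⟩
    ∑ (λ w → [ (x * w) ^ 2 ≋ x ^ 3 ])
      ≡⟨ ∑-cong (λ w → ≋-scale {i = w ^ 2} {x} {(x * w) ^ 2} {x ^ 3} (≢0-* x≢0 x≢0) (factor x w)) ⟩
    ∑ (λ w → [ w ^ 2 ≋ x ]) ∎
    where
    factor : ∀ x w → (x * w) ^ 2 - x ^ 3 ≡ (x * x) * (w ^ 2 - x)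
    factor = solve 2 (λ x w → (x :* w) :^ 2 :- x :^ 3 := (x :* x) :* (w :^ 2 :- x)) refl

  fibre-≡0 : ∀ {t} → t ≋ 0ℤ → fibre t ≡ + p
  fibre-≡0 {t} t≡0 = begin
    ∑ (λ x → ∑ (λ y → [ y ^ 2 ≋ E t x ]))
      ≡⟨ ∑-cong (λ x → ∑-cong (λ y → ≋-cong (mod-refl {y ^ 2}) (E≡x³ x))) ⟩
    ∑ (λ x → ∑ (λ y → [ y ^ 2 ≋ x ^ 3 ]))
      ≡⟨ ∑-cong cusp ⟩
    ∑ (λ x → ∑ (λ w → [ w ^ 2 ≋ x ]))
      -- Summing over `x` first leaves exactly one point for each parameter `w`.
      ≡⟨ ∑-swap (λ x w → [ w ^ 2 ≋ x ]) ⟩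
    ∑ (λ w → ∑ (λ x → [ w ^ 2 ≋ x ]))
      ≡⟨ ∑-cong (λ w → ∑-cong (λ x → ≋-⇔ (mod-sym {w ^ 2} {x}) (mod-sym {x} {w ^ 2}))) ⟩
    ∑ (λ w → ∑ (λ x → [ x ≋ w ^ 2 ]))
      ≡⟨ ∑-cong (λ w → ∑-≋ (w ^ 2)) ⟩
    ∑ (const 1ℤ)
      ≡⟨ trans (∑-const 1ℤ) (*-identityʳ (+ p)) ⟩
    + p ∎
    where
    E≡x³ : ∀ x → E t x ≋ x ^ 3
    E≡x³ x = mod-scale (t ^ 3 - t * x)
      (solve 2 (λ t x → (x :^ 3 :- t :^ 2 :* x :+ t :^ 4) :- x :^ 3 :=
                        (t :^ 3 :- t :* x) :* (t :- con 0ℤ)) refl t x) t≡0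

  -- The left side vanishes, so `z` is free while `u` runs through the three roots of `u ^ 3 ≋ u`.
  linearFibre-≡0 : ∀ {t} → t ≋ 0ℤ → linearFibre t ≡ + p * + 3
  linearFibre-≡0 {t} t≡0 = begin
    ∑ (λ u → ∑ (λ z → [ (z ^ 2 - 1ℤ) * t ≋ u ^ 3 - u ]))
      ≡⟨ ∑-cong (λ u → ∑-cong (λ z → ≋-⇔ (to u z) (from u z))) ⟩
    ∑ (λ u → ∑ (const [ u ^ 3 ≋ u ]))
      ≡⟨ ∑-cong (λ u → ∑-const [ u ^ 3 ≋ u ]) ⟩
    ∑ (λ u → + p * [ u ^ 3 ≋ u ])
      ≡⟨ ∑-*ˡ (+ p) (λ u → [ u ^ 3 ≋ u ]) ⟩
    + p * ∑ (λ u → [ u ^ 3 ≋ u ])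
      ≡⟨ cong (+ p *_) ∑-cube ⟩
    + p * + 3 ∎
    where
    st≡0 : ∀ s → s * t ≋ 0ℤ
    st≡0 s = mod-scale s (solve 2 (λ s t → s :* t :- con 0ℤ := s :* (t :- con 0ℤ)) refl s t) t≡0
    to : ∀ u z → (z ^ 2 - 1ℤ) * t ≋ u ^ 3 - u → u ^ 3 ≋ u
    to u z h = mod-scale 1ℤ (solve 2 (λ a b → a :- b := con 1ℤ :* (a :- b :- con 0ℤ)) refl (u ^ 3) u)
      (mod-trans (mod-sym h) (st≡0 (z ^ 2 - 1ℤ)))
    from : ∀ u z → u ^ 3 ≋ u → (z ^ 2 - 1ℤ) * t ≋ u ^ 3 - u
    from u z h = mod-trans (st≡0 (z ^ 2 - 1ℤ))
      (mod-scale -1ℤ (solve 2 (λ a b → con 0ℤ :- (a :- b) := con -1ℤ :* (a :- b)) refl (u ^ 3) u) h)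

  -- The correction is the discrepancy `p - 3p` at `t ≋ 0ℤ`; for other `t` the substitution is
  -- bijective.
  fibre-linearFibre : ∀ t → fibre t ≡ linearFibre t + - (+ 2 * + p) * [ t ≋ 0ℤ ]
  fibre-linearFibre t with t ≋? 0ℤ
  ... | no t≢0  = begin
    fibre t                                      ≡⟨ fibre-≢0 t≢0 ⟩
    linearFibre t
      ≡⟨ solve 2 (λ b m → b := b :+ m :* con 0ℤ) refl (linearFibre t) (- (+ 2 * + p)) ⟩
    linearFibre t + - (+ 2 * + p) * 0ℤ
      ≡⟨ cong (λ k → linearFibre t + - (+ 2 * + p) * k) (sym (𝟙-false (t ≋? 0ℤ) t≢0)) ⟩
    linearFibre t + - (+ 2 * + p) * [ t ≋ 0ℤ ]   ∎
  ... | yes t≡0 = begin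
    fibre t                                      ≡⟨ fibre-≡0 t≡0 ⟩
    + p
      ≡⟨ solve 1 (λ p → p := p :* con (+ 3) :+ :- (con (+ 2) :* p) :* con 1ℤ) refl (+ p) ⟩
    + p * + 3 + - (+ 2 * + p) * 1ℤ
      ≡⟨ cong₂ (λ b k → b + - (+ 2 * + p) * k) (sym (linearFibre-≡0 t≡0))
           (sym (𝟙-true (t ≋? 0ℤ) t≡0)) ⟩
    linearFibre t + - (+ 2 * + p) * [ t ≋ 0ℤ ]   ∎

  -- Summation over the parameter.

  ∑-linearFibre : ∑ linearFibre ≡ + p * + p + + 4 * + p
  ∑-linearFibre = begin
    ∑ (λ t → ∑ (λ u → ∑ (λ z → [ s z * t ≋ c u ])))
      ≡⟨ ∑-swap (λ t u → ∑ (λ z → [ s z * t ≋ c u ])) ⟩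
    ∑ (λ u → ∑ (λ t → ∑ (λ z → [ s z * t ≋ c u ])))
      ≡⟨ ∑-cong (λ u → ∑-swap (λ t z → [ s z * t ≋ c u ])) ⟩
    ∑ (λ u → ∑ (λ z → ∑ (λ t → [ s z * t ≋ c u ])))
      -- The innermost sum is now over `t`. Its value involves `u` and `z` in separate indicators,
      -- so the other two sums can be taken one after the other.
      ≡⟨ ∑-cong (λ u → ∑-cong (λ z → trans (∑-linear-any (s z) (c u))
           (cong₂ (λ k l → 1ℤ + (+ p * k - 1ℤ) * l) (≋0 (u ^ 3) u) (≋0 (z ^ 2) 1ℤ)))) ⟩
    ∑ (λ u → ∑ (λ z → 1ℤ + (+ p * [ u ^ 3 ≋ u ] - 1ℤ) * [ z ^ 2 ≋ 1ℤ ]))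
      ≡⟨ ∑-cong (λ u → trans (∑-affine 1ℤ (+ p * [ u ^ 3 ≋ u ] - 1ℤ) (λ z → [ z ^ 2 ≋ 1ℤ ]))
           (cong (λ n → + p * 1ℤ + (+ p * [ u ^ 3 ≋ u ] - 1ℤ) * n) ∑-square)) ⟩
    ∑ (λ u → + p * 1ℤ + (+ p * [ u ^ 3 ≋ u ] - 1ℤ) * + 2)
      -- Collecting the indicator restores the form constant plus multiple that `∑-affine` sums.
      ≡⟨ ∑-cong (λ u → solve 2 (λ p k → p :* con 1ℤ :+ (p :* k :- con 1ℤ) :* con (+ 2) :=
           (p :- con (+ 2)) :+ (con (+ 2) :* p) :* k) refl (+ p) [ u ^ 3 ≋ u ]) ⟩
    ∑ (λ u → (+ p - + 2) + (+ 2 * + p) * [ u ^ 3 ≋ u ])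
      ≡⟨ ∑-affine (+ p - + 2) (+ 2 * + p) (λ u → [ u ^ 3 ≋ u ]) ⟩
    + p * (+ p - + 2) + (+ 2 * + p) * ∑ (λ u → [ u ^ 3 ≋ u ])
      ≡⟨ cong (λ n → + p * (+ p - + 2) + (+ 2 * + p) * n) ∑-cube ⟩
    + p * (+ p - + 2) + (+ 2 * + p) * + 3
      ≡⟨ solve 1 (λ p → p :* (p :- con (+ 2)) :+ (con (+ 2) :* p) :* con (+ 3) :=
                        p :* p :+ con (+ 4) :* p) refl (+ p) ⟩
    + p * + p + + 4 * + p ∎
    where
    s c : ℤ → ℤ
    s z = z ^ 2 - 1ℤ
    c u = u ^ 3 - u
    ≋0 : ∀ i j → [ i - j ≋ 0ℤ ] ≡ [ i ≋ j ]
    ≋0 i j = ≋-scale {i = i} {j} {i - j} {0ℤ} 1≢0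
      (solve 2 (λ i j → i :- j :- con 0ℤ := con 1ℤ :* (i :- j)) refl i j)

  ∑-fibre : ∑ fibre ≡ + p * + p + + 2 * + p
  ∑-fibre = begin
    ∑ fibre
      ≡⟨ ∑-cong fibre-linearFibre ⟩
    ∑ (λ t → linearFibre t + - (+ 2 * + p) * [ t ≋ 0ℤ ])
      ≡⟨ ∑-+ linearFibre (λ t → - (+ 2 * + p) * [ t ≋ 0ℤ ]) ⟩
    ∑ linearFibre + ∑ (λ t → - (+ 2 * + p) * [ t ≋ 0ℤ ])
      ≡⟨ cong₂ _+_ ∑-linearFibre (trans (∑-*ˡ (- (+ 2 * + p)) (λ t → [ t ≋ 0ℤ ]))
           (cong (- (+ 2 * + p) *_) (∑-≋ 0ℤ))) ⟩
    + p * + p + + 4 * + p + - (+ 2 * + p) * 1ℤ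
      ≡⟨ solve 1 (λ p → p :* p :+ con (+ 4) :* p :+ :- (con (+ 2) :* p) :* con 1ℤ :=
                        p :* p :+ con (+ 2) :* p) refl (+ p) ⟩
    + p * + p + + 2 * + p ∎

lemma2p6 : (p : ℕ) → Prime p → ¬ (2 ∣ p) → firstMoment E p ≡ - (+ 2) * + p
lemma2p6 p p-prime p-odd = begin
  firstMoment E p
    ≡⟨ ∑-cong (λ t → trans (a-E t)
         (solve 2 (λ p n → p :- n := p :+ con -1ℤ :* n) refl (+ p) (fibre t))) ⟩
  ∑ (λ t → + p + -1ℤ * fibre t)
    ≡⟨ ∑-affine (+ p) -1ℤ fibre ⟩
  + p * + p + -1ℤ * ∑ fibre
    ≡⟨ cong (λ n → + p * + p + -1ℤ * n) ∑-fibre ⟩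
  + p * + p + -1ℤ * (+ p * + p + + 2 * + p)
    ≡⟨ solve 1 (λ p → p :* p :+ con -1ℤ :* (p :* p :+ con (+ 2) :* p) := :- con (+ 2) :* p)
         refl (+ p) ⟩
  - (+ 2) * + p ∎
  where open OddPrimeModulus p p-prime p-odd
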